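{- A maximum $6\times 6$ board contains twenty-two prisoners. That is, $P(6)=22$.
   Context: A configuration on an $n\times n$ board assigns to each of the $n^2$ squares exactly one occupant, either a prisoner or a guard. Two distinct squares are adjacent if one is directly above, below, to the left, to the right, or diagonal to the other (king-move adjacency). A configuration is valid (a valid board) if every square occupied by a prisoner is adjacent to at least as many squares occupied by guards as squares occupied by (other) prisoners. A maximum configuration (maximum board) is a valid board that has the greatest number of prisoners among all valid boards on the $n\times n$ board. $P(n)$ denotes the number of prisoners in a maximum configuration on the $n\times n$ board. -}

module Defs where

open import Data.Fin.Base using (Fin; toℕ)
open import Data.Fin.Properties using (all?) renaming (_≟_ to _≟ᶠ_)
open import Data.List.Base
  using (List; []; _∷_; length; filter; allFin; cartesianProduct; cartesianProductWith)
open import Data.List.Extrema.Nat using (argmax; argmax-all; f[xs]≤f[argmax])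
open import Data.List.Membership.Propositional using (_∈_)
open import Data.List.Membership.Propositional.Properties
  using (∈-filter⁺; ∈-cartesianProductWith⁺)
open import Data.List.Relation.Unary.All as All using ()
open import Data.List.Relation.Unary.All.Properties using (all-filter)
open import Data.List.Relation.Unary.Any using (here; there)
open import Data.Nat.Base using (ℕ; zero; suc; _≤_; ∣_-_∣)
open import Data.Nat.Properties using (_≤?_)
open import Data.Product.Base using (_×_; _,_; proj₁; ∃)
open import Data.Product.Properties using (≡-dec)
open import Data.Vec.Base using (Vec; []; _∷_; lookup; replicate)
open import Data.Vec.Properties using (lookup-replicate)
open import Relation.Binary.Definitions using (DecidableEquality)
open import Relation.Binary.PropositionalEquality
  using (_≡_; _≢_; refl; sym; trans; cong)
open import Relation.Nullary using (Dec; yes; no; ¬?; contradiction)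
open import Relation.Nullary.Decidable using (_×-dec_; _→-dec_; map′)

data Occupant : Set where
  prisoner guard : Occupant

_≟ᵒ_ : DecidableEquality Occupant
prisoner ≟ᵒ prisoner = yes refl
prisoner ≟ᵒ guard    = no λ ()
guard    ≟ᵒ prisoner = no λ ()
guard    ≟ᵒ guard    = yes refl

Square : ℕ → Set
Square n = Fin n × Fin n

squares : ∀ n → List (Square n)
squares n = cartesianProduct (allFin n) (allFin n)

_≟ˢ_ : ∀ {n} → DecidableEquality (Square n)
_≟ˢ_ = ≡-dec _≟ᶠ_ _≟ᶠ_

Board : ℕ → Set
Board n = Vec (Vec Occupant n) n

occupant : ∀ {n} → Board n → Square n → Occupant
occupant B (i , j) = lookup (lookup B i) j

-- King-move adjacency: distinct squares whose rows and whose columns each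
-- differ by at most one.
Adjacent : ∀ {n} → Square n → Square n → Set
Adjacent s@(i , j) t@(k , l) =
  s ≢ t × ∣ toℕ i - toℕ k ∣ ≤ 1 × ∣ toℕ j - toℕ l ∣ ≤ 1

adjacent? : ∀ {n} (s t : Square n) → Dec (Adjacent s t)
adjacent? s@(i , j) t@(k , l) =
  ¬? (s ≟ˢ t) ×-dec (∣ toℕ i - toℕ k ∣ ≤? 1) ×-dec (∣ toℕ j - toℕ l ∣ ≤? 1)

count : ∀ {n} → Occupant → Board n → ℕ
count {n} o B = length (filter (λ s → occupant B s ≟ᵒ o) (squares n))

neighbours : ∀ {n} → Occupant → Board n → Square n → ℕ
neighbours {n} o B s =
  length (filter (λ t → adjacent? s t ×-dec (occupant B t ≟ᵒ o)) (squares n))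

Valid : ∀ {n} → Board n → Set
Valid {n} B = (s : Square n) → occupant B s ≡ prisoner →
  neighbours prisoner B s ≤ neighbours guard B s

Maximum : ∀ {n} → Board n → Set
Maximum {n} B =
  Valid B × ((C : Board n) → Valid C → count prisoner C ≤ count prisoner B)

valid? : ∀ {n} (B : Board n) → Dec (Valid B)
valid? B = map′ (λ v (i , j) → v i j) (λ v i j → v (i , j))
  (all? λ i → all? λ j → (occupant B (i , j) ≟ᵒ prisoner) →-dec
    (neighbours prisoner B (i , j) ≤? neighbours guard B (i , j)))

vectors : ∀ {A : Set} → List A → ∀ n → List (Vec A n)
vectors xs zero    = [] ∷ []
vectors xs (suc n) = cartesianProductWith _∷_ xs (vectors xs n)

vectors-complete : ∀ {A : Set} {xs : List A} → (∀ x → x ∈ xs) →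
                   ∀ {n} (v : Vec A n) → v ∈ vectors xs n
vectors-complete all∈ []      = here refl
vectors-complete all∈ (x ∷ v) =
  ∈-cartesianProductWith⁺ _∷_ (all∈ x) (vectors-complete all∈ v)

boards : ∀ n → List (Board n)
boards n = vectors (vectors (prisoner ∷ guard ∷ []) n) n

boards-complete : ∀ {n} (B : Board n) → B ∈ boards n
boards-complete = vectors-complete (vectors-complete occupants-complete)
  where
  occupants-complete : ∀ o → o ∈ prisoner ∷ guard ∷ []
  occupants-complete prisoner = here refl
  occupants-complete guard    = there (here refl)

allGuards : ∀ n → Board n
allGuards n = replicate n (replicate n guard)

allGuards-valid : ∀ n → Valid (allGuards n)
allGuards-valid n (i , j) isPrisoner =
  contradiction (trans (sym isGuard) isPrisoner) λ ()
  where
  isGuard : occupant (allGuards n) (i , j) ≡ guard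
  isGuard = trans (cong (λ row → lookup row j) (lookup-replicate i (replicate n guard)))
                  (lookup-replicate j guard)

-- Opaque so that the type checker never enumerates the 2 ^ (n * n) boards when
-- it normalises P n; the type says all there is to know about the witness.
opaque
  maximum-exists : ∀ n → ∃ λ (B : Board n) → Maximum B
  maximum-exists n = best , best-valid , best-max
    where
    candidates : List (Board n)
    candidates = filter valid? (boards n)

    best : Board n
    best = argmax (count prisoner) (allGuards n) candidates

    best-valid : Valid best
    best-valid = argmax-all (count prisoner) {P = Valid} (allGuards-valid n)
      (all-filter valid? (boards n))

    best-max : (C : Board n) → Valid C → count prisoner C ≤ count prisoner best
    best-max C v = All.lookup (f[xs]≤f[argmax] {f = count prisoner} (allGuards n) candidates)
      (∈-filter⁺ valid? (boards-complete C) v)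

-- All maximum boards have equally many prisoners (by maximality of each), so
-- the choice of maximum board is immaterial.
P : ℕ → ℕ
P n = count prisoner (proj₁ (maximum-exists n))

{-# OPTIONS --safe #-}
-- Write N(s) for the number of prisoners around s, and x(s) for the number on s.
-- Validity says N(s) + ⌈deg s /2⌉ x(s) ≤ deg s for every square s.  Add these
-- inequalities for the four central squares (each bounded by 8) and for the eight
-- border squares in the two middle rows or columns (each bounded by 5).  What
-- is missing to make every coefficient equal to 7 is, on each 3 × 3 quadrant, the
-- weighting
--
--     7 6 3
--     6 4 3
--     3 3 0
--
-- with the 7 in the corner of the board, and validity on the four squares nearest
-- to that corner forces the weighted number of prisoners to be at most 22.  Hence
-- 7 · count ≤ 4 · 22 + 4 · 8 + 8 · 5 = 160 < 7 · 23.  (The weighting is dual to a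
-- linear program.)
module Submission where

open import Defs
open import Data.Bool.Base using (true; false; if_then_else_)
open import Data.Fin.Base using (Fin; suc; inject₁; opposite; combine)
open import Data.Fin.Patterns using (0F; 1F; 2F; 3F; 5F)
open import Data.Fin.Properties using (all?)
open import Data.List.Base
  using (List; []; _∷_; _++_; length; map; filter; concatMap; replicate; allFin; cartesianProduct)
open import Data.List.Membership.Propositional using (_∈_)
open import Data.List.Membership.Propositional.Properties using (∈-cartesianProduct⁺; ∈-allFin)
open import Data.List.Properties using (map-++; map-∘; map-cong; ≡-dec)
open import Data.List.Relation.Unary.All as All using (All; []; _∷_)
open import Data.List.Relation.Unary.Any using (here; there)
open import Data.List.Relation.Unary.AllPairs using ([]; _∷_)
open import Data.List.Relation.Unary.Unique.Propositional using (Unique)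
import Data.List.Relation.Unary.Unique.Propositional.Properties as Unique
open import Data.Nat.Base using (ℕ; zero; suc; _+_; _*_; _≤_; z≤n; s≤s⁻¹; ⌊_/2⌋; ⌈_/2⌉)
open import Data.Nat.ListAction using (sum)
open import Data.Nat.ListAction.Properties using (sum-++)
open import Data.Nat.Properties
open import Data.Nat.Tactic.RingSolver using (solve-∀)
open import Data.Product.Base using (_×_; _,_; proj₁; proj₂)
open import Data.Vec.Base using ([]; _∷_; lookup; tabulate)
open import Data.Vec.Properties using (lookup∘tabulate)
open import Function.Base using (_∘_)
open import Relation.Binary.Definitions using (DecidableEquality)
open import Relation.Binary.PropositionalEquality
  using (_≡_; _≢_; refl; sym; trans; cong; cong₂; subst; subst₂; module ≡-Reasoning)
open import Relation.Nullary using (Dec; does; yes; no; contradiction)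
open import Relation.Nullary.Decidable using (_×-dec_; _→-dec_; toWitness)

private
  variable
    A C : Set
    n : ℕ

-- Weighted sums as tallies over lists.

𝟙 : Dec A → ℕ
𝟙 d = if does d then 1 else 0

-- A linear form with coefficients in ℕ is encoded as a list that repeats each element as often as
-- its coefficient; adding two forms is then concatenation.
tally : (A → ℕ) → List A → ℕ
tally x as = sum (map x as)

tally-++ : (x : A → ℕ) (as bs : List A) → tally x (as ++ bs) ≡ tally x as + tally x bs
tally-++ x as bs = trans (cong sum (map-++ x as bs)) (sum-++ (map x as) (map x bs))

tally-replicate : (x : A → ℕ) (k : ℕ) (a : A) → tally x (replicate k a) ≡ k * x a
tally-replicate x zero    a = refl
tally-replicate x (suc k) a = cong (x a +_) (tally-replicate x k a)

tally-map : (x : C → ℕ) (f : A → C) (as : List A) → tally (x ∘ f) as ≡ tally x (map f as)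
tally-map x f as = cong sum (map-∘ as)

tally-cong : {x y : A → ℕ} → (∀ a → x a ≡ y a) → (as : List A) → tally x as ≡ tally y as
tally-cong x≗y as = cong sum (map-cong x≗y as)

tally-mono : {x y : A → ℕ} → (∀ a → x a ≤ y a) → (as : List A) → tally x as ≤ tally y as
tally-mono x≤y []       = z≤n
tally-mono x≤y (a ∷ as) = +-mono-≤ (x≤y a) (tally-mono x≤y as)

tally-concatMap-≤ : (x : C → ℕ) (f : A → List C) (b : A → ℕ) → (∀ a → tally x (f a) ≤ b a) →
                    (as : List A) → tally x (concatMap f as) ≤ tally b as
tally-concatMap-≤ x f b f≤b []       = z≤n
tally-concatMap-≤ x f b f≤b (a ∷ as) = ≤-trans
  (≤-reflexive (tally-++ x (f a) (concatMap f as)))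
  (+-mono-≤ (f≤b a) (tally-concatMap-≤ x f b f≤b as))

tally-+ : (x y : A → ℕ) (as : List A) → tally (λ a → x a + y a) as ≡ tally x as + tally y as
tally-+ x y []       = refl
tally-+ x y (a ∷ as) = trans (cong (x a + y a +_) (tally-+ x y as)) (interchange (x a) (y a) _ _)
  where
  interchange : ∀ k l m o → (k + l) + (m + o) ≡ (k + m) + (l + o)
  interchange = solve-∀

tally-concatMap-replicate : (x : A → ℕ) (k : ℕ) (as : List A) →
                            tally x (concatMap (replicate k) as) ≡ k * tally x as
tally-concatMap-replicate x k []       = sym (*-zeroʳ k)
tally-concatMap-replicate x k (a ∷ as) = begin
  tally x (replicate k a ++ concatMap (replicate k) as)
    ≡⟨ tally-++ x (replicate k a) _ ⟩
  tally x (replicate k a) + tally x (concatMap (replicate k) as)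
    ≡⟨ cong₂ _+_ (tally-replicate x k a) (tally-concatMap-replicate x k as) ⟩
  k * x a + k * tally x as
    ≡⟨ *-distribˡ-+ k (x a) (tally x as) ⟨
  k * tally x (a ∷ as) ∎
  where open ≡-Reasoning

-- Separates adjacency from occupancy, so that prisoners and guards around a square are tallied over
-- one and the same list.
length-filter-× : {P Q : A → Set} (P? : ∀ a → Dec (P a)) (Q? : ∀ a → Dec (Q a)) (as : List A) →
                  length (filter (λ a → P? a ×-dec Q? a) as) ≡ tally (𝟙 ∘ Q?) (filter P? as)
length-filter-× P? Q? []       = refl
length-filter-× P? Q? (a ∷ as) with does (P? a)
... | false = length-filter-× P? Q? as
... | true  with does (Q? a)
...   | false = length-filter-× P? Q? as
...   | true  = cong suc (length-filter-× P? Q? as)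

length-filter-tally : {P : A → Set} (P? : ∀ a → Dec (P a)) (as : List A) →
                      length (filter P? as) ≡ tally (𝟙 ∘ P?) as
length-filter-tally P? []       = refl
length-filter-tally P? (a ∷ as) with does (P? a)
... | false = length-filter-tally P? as
... | true  = cong suc (length-filter-tally P? as)

-- Comparing tallies through multiplicities.

module Multiplicity {A : Set} (_≟_ : DecidableEquality A) where

  multiplicity : A → List A → ℕ
  multiplicity a = tally λ b → 𝟙 (b ≟ a)

  tally-δ-∉ : (x : A → ℕ) {a : A} {as : List A} → All (a ≢_) as →
              tally (λ b → 𝟙 (a ≟ b) * x b) as ≡ 0
  tally-δ-∉ x []                         = refl
  tally-δ-∉ x {a} {b ∷ _} (a≢b ∷ a∉as) with a ≟ b
  ... | yes a≡b = contradiction a≡b a≢b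
  ... | no  _   = tally-δ-∉ x a∉as

  tally-δ : (x : A → ℕ) {a : A} {as : List A} → Unique as → a ∈ as →
            tally (λ b → 𝟙 (a ≟ b) * x b) as ≡ x a
  tally-δ x {a} (a∉as ∷ _) (here refl) with a ≟ a
  ... | yes _   = trans (cong₂ _+_ (*-identityˡ (x a)) (tally-δ-∉ x a∉as)) (+-identityʳ (x a))
  ... | no  a≢a = contradiction refl a≢a
  tally-δ x {a} {b ∷ _} (b∉as ∷ unique) (there a∈as) with a ≟ b
  ... | yes refl = contradiction refl (All.lookup b∉as a∈as)
  ... | no  _    = tally-δ x unique a∈as

  module _ {enum : List A} (unique : Unique enum) (complete : ∀ a → a ∈ enum) where

    -- Double counting: each `x a` is expanded by `tally-δ` into a Kronecker delta sum over `enum`,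
    -- and the deltas add up to multiplicities.
    tally-by-multiplicity : (x : A → ℕ) (as : List A) →
                            tally x as ≡ tally (λ b → multiplicity b as * x b) enum
    tally-by-multiplicity x [] = sym (tally-zero enum)
      where
      tally-zero : ∀ bs → tally (λ b → 0 * x b) bs ≡ 0
      tally-zero []       = refl
      tally-zero (_ ∷ bs) = tally-zero bs
    tally-by-multiplicity x (a ∷ as) = begin
      x a + tally x as
        ≡⟨ cong₂ _+_ (sym (tally-δ x unique (complete a))) (tally-by-multiplicity x as) ⟩
      tally (λ b → 𝟙 (a ≟ b) * x b) enum + tally (λ b → multiplicity b as * x b) enum
        ≡⟨ tally-+ _ _ enum ⟨
      tally (λ b → 𝟙 (a ≟ b) * x b + multiplicity b as * x b) enum
        ≡⟨ tally-cong (λ b → sym (*-distribʳ-+ (x b) (𝟙 (a ≟ b)) (multiplicity b as))) enum ⟩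
      tally (λ b → multiplicity b (a ∷ as) * x b) enum ∎
      where open ≡-Reasoning

    -- Turns an inequality between linear forms in an unknown board into a comparison of
    -- coefficients, which can be decided by evaluation.
    tally-⊆ : (x : A → ℕ) (as bs : List A) → (∀ c → multiplicity c as ≤ multiplicity c bs) →
              tally x as ≤ tally x bs
    tally-⊆ x as bs as⊆bs = subst₂ _≤_
      (sym (tally-by-multiplicity x as)) (sym (tally-by-multiplicity x bs))
      (tally-mono (λ c → *-monoˡ-≤ (x c) (as⊆bs c)) enum)

-- The inequality that validity gives at one square.

squares-complete : (s : Square n) → s ∈ squares n
squares-complete (i , j) = ∈-cartesianProduct⁺ (∈-allFin i) (∈-allFin j)

squares-unique : ∀ n → Unique (squares n)
squares-unique n = Unique.cartesianProduct⁺ (Unique.allFin⁺ n) (Unique.allFin⁺ n)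

occupied : Occupant → Board n → Square n → ℕ
occupied o B s = 𝟙 (occupant B s ≟ᵒ o)

neighbourhood : Square n → List (Square n)
neighbourhood {n} s = filter (adjacent? s) (squares n)

degree : Square n → ℕ
degree s = length (neighbourhood s)

neighbours-tally : ∀ o (B : Board n) s → neighbours o B s ≡ tally (occupied o B) (neighbourhood s)
neighbours-tally {n} o B s = length-filter-× (adjacent? s) (λ t → occupant B t ≟ᵒ o) (squares n)

tally-occupied : (B : Board n) (ss : List (Square n)) →
                 tally (occupied prisoner B) ss + tally (occupied guard B) ss ≡ length ss
tally-occupied B []       = refl
tally-occupied B (s ∷ ss) with occupant B s
... | prisoner = cong suc (tally-occupied B ss)
... | guard    = trans (+-suc _ _) (cong suc (tally-occupied B ss))

-- The form `N(s) + ⌈deg s /2⌉ x(s)`.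
localBag : Square n → List (Square n)
localBag s = replicate ⌈ degree s /2⌉ s ++ neighbourhood s

m+m≤n⇒m≤⌊n/2⌋ : ∀ {m n} → m + m ≤ n → m ≤ ⌊ n /2⌋
m+m≤n⇒m≤⌊n/2⌋ {m} m+m≤n = subst (_≤ _) (sym (n≡⌊n+n/2⌋ m)) (⌊n/2⌋-mono m+m≤n)

-- With a guard on `s` the first term vanishes and the neighbourhood holds at most `degree s`
-- prisoners. With a prisoner on `s`, validity leaves at most half of the neighbourhood to
-- prisoners, and the floor and ceiling of the half add up to `degree s`.
local-bound : {B : Board n} → Valid B → ∀ s → tally (occupied prisoner B) (localBag s) ≤ degree s
local-bound {B = B} valid s = begin
  tally x (localBag s)                      ≡⟨ tally-++ x (replicate h s) (neighbourhood s) ⟩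
  tally x (replicate h s) + N prisoner      ≡⟨ cong (_+ N prisoner) (tally-replicate x h s) ⟩
  h * x s + N prisoner                      ≤⟨ by-occupant (occupant B s) refl ⟩
  degree s                                  ∎
  where
  open ≤-Reasoning
  x : Square _ → ℕ
  x = occupied prisoner B
  h : ℕ
  h = ⌈ degree s /2⌉
  N : Occupant → ℕ
  N o = tally (occupied o B) (neighbourhood s)
  by-occupant : ∀ o → occupant B s ≡ o → h * 𝟙 (occupant B s ≟ᵒ prisoner) + N prisoner ≤ degree s
  by-occupant guard eq rewrite eq | *-zeroʳ h =
    subst (N prisoner ≤_) (tally-occupied B (neighbourhood s)) (m≤m+n _ _)
  by-occupant prisoner eq = begin
    h * 𝟙 (occupant B s ≟ᵒ prisoner) + N prisoner
      ≡⟨ cong (λ o → h * 𝟙 (o ≟ᵒ prisoner) + N prisoner) eq ⟩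
    h * 1 + N prisoner         ≡⟨ cong (_+ N prisoner) (*-identityʳ h) ⟩
    h + N prisoner             ≤⟨ +-monoʳ-≤ h (m+m≤n⇒m≤⌊n/2⌋ half) ⟩
    h + ⌊ degree s /2⌋         ≡⟨ +-comm h _ ⟩
    ⌊ degree s /2⌋ + h         ≡⟨ ⌊n/2⌋+⌈n/2⌉≡n (degree s) ⟩
    degree s                   ∎
    where
    half : N prisoner + N prisoner ≤ degree s
    half = begin
      N prisoner + N prisoner
        ≤⟨ +-monoʳ-≤ (N prisoner)
             (subst₂ _≤_ (neighbours-tally prisoner B s) (neighbours-tally guard B s) (valid s eq)) ⟩
      N prisoner + N guard     ≡⟨ tally-occupied B (neighbourhood s) ⟩
      degree s                 ∎

-- Weighted bound on each quadrant.

-- The quadrant (p , q) consists of the rows 3 p + i and the columns 3 q + j.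
module Quadrant (p q : Fin 2) where

  embed : Square 3 → Square 6
  embed (i , j) = combine p i , combine q j

  window : Board 6 → Board 3
  window B = tabulate λ i → tabulate λ j → occupant B (embed (i , j))

  -- Measures distance from the edge of the large board, so that one weight matrix, suitably
  -- reflected, serves all four quadrants.
  fromBorder : Fin 2 → Fin 3 → Fin 3
  fromBorder 0F i = i
  fromBorder 1F i = opposite i

  weight : Square 3 → ℕ
  weight (i , j) = lookup (lookup
    ((7 ∷ 6 ∷ 3 ∷ []) ∷
     (6 ∷ 4 ∷ 3 ∷ []) ∷
     (3 ∷ 3 ∷ 0 ∷ []) ∷ []) (fromBorder p i)) (fromBorder q j)

  bag : List (Square 3)
  bag = concatMap (λ s → replicate (weight s) s) (squares 3)

  -- The four squares whose neighbourhood in the large board stays in the quadrant.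
  inner : Fin 2 → Fin 2 → Square 3
  inner i j = shift p i , shift q j
    where
    shift : Fin 2 → Fin 2 → Fin 3
    shift 0F = inject₁
    shift 1F = suc

  InnerValid : Board 3 → Set
  InnerValid Q = ∀ i j → occupant Q (inner i j) ≡ prisoner →
    neighbours prisoner Q (inner i j) ≤ neighbours guard Q (inner i j)

  innerValid? : ∀ Q → Dec (InnerValid Q)
  innerValid? Q = all? λ i → all? λ j → (occupant Q (inner i j) ≟ᵒ prisoner) →-dec
    (neighbours prisoner Q (inner i j) ≤? neighbours guard Q (inner i j))

  occupant-window : ∀ B s → occupant (window B) s ≡ occupant B (embed s)
  occupant-window B (i , j) = trans
    (cong (λ row → lookup row j) (lookup∘tabulate (λ k → tabulate λ l → occupant B (embed (k , l))) i))
    (lookup∘tabulate (λ l → occupant B (embed (i , l))) j)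

  tally-window : ∀ o B ss → tally (occupied o (window B)) ss ≡ tally (occupied o B) (map embed ss)
  tally-window o B ss = trans
    (tally-cong (λ s → cong (λ o′ → 𝟙 (o′ ≟ᵒ o)) (occupant-window B s)) ss)
    (tally-map (occupied o B) embed ss)

open Quadrant using (inner; InnerValid; innerValid?; embed; window; bag)

-- Equality of lists, order included: `embed` preserves the lexicographic order in which squares are
-- enumerated.
embed-neighbourhood : ∀ p q i j → map (embed p q) (neighbourhood (inner p q i j)) ≡
                                  neighbourhood (embed p q (inner p q i j))
embed-neighbourhood = toWitness {a? = all? λ p → all? λ q → all? λ i → all? λ j →
  ≡-dec _≟ˢ_ _ _} _

neighbours-window : ∀ p q o B i j → neighbours o (window p q B) (inner p q i j) ≡
                                    neighbours o B (embed p q (inner p q i j))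
neighbours-window p q o B i j = begin
  neighbours o (window p q B) s
    ≡⟨ neighbours-tally o (window p q B) s ⟩
  tally (occupied o (window p q B)) (neighbourhood s)
    ≡⟨ Quadrant.tally-window p q o B (neighbourhood s) ⟩
  tally (occupied o B) (map (embed p q) (neighbourhood s))
    ≡⟨ cong (tally (occupied o B)) (embed-neighbourhood p q i j) ⟩
  tally (occupied o B) (neighbourhood (embed p q s))
    ≡⟨ neighbours-tally o B (embed p q s) ⟨
  neighbours o B (embed p q s) ∎
  where
  open ≡-Reasoning
  s : Square 3
  s = inner p q i j

window-valid : ∀ p q {B} → Valid B → InnerValid p q (window p q B)
window-valid p q {B} valid i j isPrisoner = subst₂ _≤_
  (sym (neighbours-window p q prisoner B i j)) (sym (neighbours-window p q guard B i j))
  (valid _ (trans (sym (Quadrant.occupant-window p q B (inner p q i j))) isPrisoner))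

-- A finite check: for each quadrant, all 512 boards of size 3 are run through the four inner
-- conditions.
bag-bound : ∀ p q Q → InnerValid p q Q → tally (occupied prisoner Q) (bag p q) ≤ 22
bag-bound p q Q = All.lookup (exhaustive p q) (boards-complete Q)
  where
  exhaustive : ∀ p q →
    All (λ Q → InnerValid p q Q → tally (occupied prisoner Q) (bag p q) ≤ 22) (boards 3)
  exhaustive = toWitness {a? = all? λ p → all? λ q →
    All.all? (λ Q → innerValid? p q Q →-dec (_ ≤? 22)) (boards 3)} _

-- Combining the bounds.

quadrants : List (Fin 2 × Fin 2)
quadrants = cartesianProduct (allFin 2) (allFin 2)

quadrantBag : Fin 2 × Fin 2 → List (Square 6)
quadrantBag (p , q) = map (embed p q) (bag p q)

quadrant-bound : ∀ {B} → Valid B → ∀ pq → tally (occupied prisoner B) (quadrantBag pq) ≤ 22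
quadrant-bound {B} valid (p , q) = subst (_≤ 22) (Quadrant.tally-window p q prisoner B (bag p q))
  (bag-bound p q (window p q B) (window-valid p q {B} valid))

crossSquares : List (Square 6)
crossSquares = cartesianProduct middle middle ++ cartesianProduct middle border ++
               cartesianProduct border middle
  where
  middle border : List (Fin 6)
  middle = 2F ∷ 3F ∷ []
  border = 0F ∷ 5F ∷ []

sevenfold : List (Square 6)
sevenfold = concatMap (replicate 7) (squares 6)

cover : List (Square 6)
cover = concatMap localBag crossSquares ++ concatMap quadrantBag quadrants

open Multiplicity (_≟ˢ_ {6})

-- The weights were chosen so that both multiplicities are 7 at each of the 36 squares.
sevenfold⊆cover : ∀ s → multiplicity s sevenfold ≤ multiplicity s cover
sevenfold⊆cover (i , j) = toWitness {a? = all? λ i → all? λ j →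
  multiplicity (i , j) sevenfold ≤? multiplicity (i , j) cover} _ i j

valid⇒count≤22 : {B : Board 6} → Valid B → count prisoner B ≤ 22
valid⇒count≤22 {B} valid = s≤s⁻¹ (*-cancelˡ-< 7 (count prisoner B) 23 (begin-strict
  7 * count prisoner B
    ≡⟨ cong (7 *_) (length-filter-tally (λ s → occupant B s ≟ᵒ prisoner) (squares 6)) ⟩
  7 * tally x (squares 6)
    ≡⟨ tally-concatMap-replicate x 7 (squares 6) ⟨
  tally x sevenfold
    ≤⟨ tally-⊆ (squares-unique 6) squares-complete x sevenfold cover sevenfold⊆cover ⟩
  tally x cover
    ≡⟨ tally-++ x (concatMap localBag crossSquares) (concatMap quadrantBag quadrants) ⟩
  tally x (concatMap localBag crossSquares) + tally x (concatMap quadrantBag quadrants)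
    ≤⟨ +-mono-≤ (tally-concatMap-≤ x localBag degree (local-bound {B = B} valid) crossSquares)
                (tally-concatMap-≤ x quadrantBag (λ _ → 22) (quadrant-bound {B} valid) quadrants) ⟩
  -- The degrees of the cross squares sum to 72 and the quadrant bounds to 88.
  160
    <⟨ n<1+n 160 ⟩
  7 * 23 ∎))
  where
  open ≤-Reasoning
  x : Square 6 → ℕ
  x = occupied prisoner B

-- A board attaining the bound.

optimal : Board 6
optimal =
  (● ∷ ● ∷ ● ∷ ● ∷ ● ∷ ● ∷ []) ∷
  (○ ∷ ○ ∷ ○ ∷ ○ ∷ ○ ∷ ○ ∷ []) ∷
  (● ∷ ● ∷ ● ∷ ● ∷ ● ∷ ● ∷ []) ∷
  (● ∷ ○ ∷ ● ∷ ● ∷ ○ ∷ ● ∷ []) ∷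
  (○ ∷ ○ ∷ ○ ∷ ○ ∷ ○ ∷ ○ ∷ []) ∷
  (● ∷ ● ∷ ● ∷ ● ∷ ● ∷ ● ∷ []) ∷ []
  where
  ● ○ : Occupant
  ● = prisoner
  ○ = guard

optimal-valid : Valid optimal
optimal-valid = toWitness {a? = valid? optimal} _

maximum⇒count≡22 : (B : Board 6) → Maximum B → count prisoner B ≡ 22
maximum⇒count≡22 B (valid , maximal) =
  -- `count prisoner optimal` evaluates to 22, which gives the lower bound.
  ≤-antisym (valid⇒count≤22 {B} valid) (maximal optimal optimal-valid)

proposition3p4 : ((B : Board 6) → Maximum B → count prisoner B ≡ 22) × P 6 ≡ 22
proposition3p4 =
  -- `P 6` unfolds to the count of an opaque witness; its maximality alone fixes the value.
  maximum⇒count≡22 , maximum⇒count≡22 (proj₁ (maximum-exists 6)) (proj₂ (maximum-exists 6))
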